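{- Let $T$ be a tree of height $\omega_1$ with a cofinal branch. Then $\diamondsuit$ implies $\diamondsuit_T$. Additionally, if $T$ is an $\omega_1$-tree, then $\diamondsuit$ and $\diamondsuit_T$ are equivalent.
   Context: A tree is a partial order $(T,<_T)$ in which the set of predecessors of each node is well-ordered; every tree is assumed to have a root, denoted $\emptyset$. For $t\in T$, $t{\downarrow}=\{s\in T\mid s<_T t\}$, $\mathrm{ht}(t)$ is the order type of $t{\downarrow}$, and $T_\alpha$ is the set of nodes of height $\alpha$. The height of $T$ is the least $\alpha$ with $T_\alpha=\emptyset$. An $\omega_1$-tree is a tree of height $\omega_1$ all of whose levels $T_\alpha$ are countable. An antichain is a set of pairwise incomparable nodes; a cofinal branch is a chain $B\subseteq T$ with $B\cap T_\alpha\neq\emptyset$ for all $\alpha<\mathrm{ht}(T)$. A set $U\subseteq T$ is special if it is a union of at most countably many antichains; otherwise it is nonspecial (a tree of height $\omega_1$ with a cofinal branch is nonspecial). For $X\subseteq T$, a map $f:X\to T$ is regressive if $f(t)<_T t$ for all $t\in X\setminus\{\emptyset\}$. For $T$ of height $\omega_1$, $NS^T$ is the ideal of all $B\subseteq T$ for which there is a regressive $f:B\to T$ such that $f^{ -1}(\{t\})$ is special for every $t\in T$. For a nonspecial tree $T$ of height $\omega_1$, $\diamondsuit_T$ asserts that there is a sequence $(D_t\mid t\in T)$ with $D_t\subseteq t{\downarrow}$ for all $t\in T$ such that for every $X\subseteq T$, $\{t\in T\mid X\cap t{\downarrow}=D_t\}\notin NS^T$. $\diamondsuit$ is Jensen's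 principle: there is $(D_\alpha)_{\alpha<\omega_1}$ with $D_\alpha\subseteq\alpha$ such that for every $X\subseteq\omega_1$ the set $\{\alpha<\omega_1\mid X\cap\alpha=D_\alpha\}$ is stationary. -}

module Defs where

open import Level using (Level; _⊔_; suc)
open import Data.Nat.Base using (ℕ)
open import Data.Product.Base using (Σ; ∃; _×_; proj₁)
open import Data.Sum.Base using (_⊎_)
open import Function.Base using (_on_)
open import Induction.WellFounded using (WellFounded)
open import Relation.Binary.Core using (Rel)
open import Relation.Binary.Structures using (IsStrictPartialOrder; IsStrictTotalOrder)
open import Relation.Binary.Morphism.Structures using (IsOrderIsomorphism)
open import Relation.Binary.PropositionalEquality.Core using (_≡_; _≢_)
open import Relation.Nullary.Negation.Core using (¬_)
open import Relation.Unary
  using (Pred; U; _∈_; _⊆_; _≐_; _∩_; _≬_; ⋃; Empty; Satisfiable)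

private variable
  a b ℓ p q : Level

-- Subsets are predicates, compared extensionally by _≐_.  A subset P, viewed as
-- a structure in its own right, is Σ A P; its elements are compared by first
-- components only, so that proofs of membership play no role.

record IsWellOrder {A : Set a} (_≈_ : Rel A b) (_<_ : Rel A ℓ) : Set (a ⊔ b ⊔ ℓ) where
  field
    isStrictTotalOrder : IsStrictTotalOrder _≈_ _<_
    wellFounded        : WellFounded _<_

IsWellOrdered : {A : Set a} → Rel A ℓ → Pred A p → Set (a ⊔ ℓ ⊔ p)
IsWellOrdered {A = A} _<_ P = IsWellOrder {A = Σ A P} (_≡_ on proj₁) (_<_ on proj₁)

SameOrderType : {A : Set a} {B : Set b} →
                Rel A ℓ → Pred A p → Rel B ℓ → Pred B q → Set (a ⊔ b ⊔ ℓ ⊔ p ⊔ q)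
SameOrderType {A = A} {B = B} _<₁_ P _<₂_ Q =
  ∃ λ (f : Σ A P → Σ B Q) →
    IsOrderIsomorphism (_≡_ on proj₁) (_≡_ on proj₁) (_<₁_ on proj₁) (_<₂_ on proj₁) f

-- Finite (including empty) subsets count as countable.
Countable : {A : Set a} → Pred A p → Set (a ⊔ p)
Countable {A = A} P =
  ∃ λ (f : A → ℕ) → ∀ {x y} → x ∈ P → y ∈ P → f x ≡ f y → x ≡ y

-- A presentation of ω₁, the least uncountable ordinal: an uncountable well-order
-- all of whose proper initial segments are countable.  It is unique up to
-- isomorphism; an element α stands for the countable ordinal { β | β < α }.
record Omega₁ ℓ : Set (suc ℓ) where
  infix 4 _<_
  field
    Carrier     : Set ℓ
    _<_         : Rel Carrier ℓ
    isWellOrder : IsWellOrder _≡_ _<_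
    uncountable : ¬ Countable {A = Carrier} U
    countable↓  : ∀ α → Countable (_< α)

  _↓ : Carrier → Pred Carrier ℓ
  (α ↓) β = β < α

record Tree ℓ : Set (suc ℓ) where
  infix 4 _<_
  field
    Carrier              : Set ℓ
    _<_                  : Rel Carrier ℓ
    isStrictPartialOrder : IsStrictPartialOrder _≡_ _<_
    wellOrdered↓         : ∀ t → IsWellOrdered _<_ (_< t)
    root                 : Carrier
    root-least           : ∀ t → t ≢ root → root < t

  _↓ : Carrier → Pred Carrier ℓ
  (t ↓) s = s < t

  Comparable : Rel Carrier ℓ
  Comparable s t = s < t ⊎ s ≡ t ⊎ t < s

  Chain : Pred Carrier ℓ → Set ℓ
  Chain B = ∀ {s t} → s ∈ B → t ∈ B → Comparable s t

  Antichain : Pred Carrier ℓ → Set ℓ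
  Antichain A = ∀ {s t} → s ∈ A → t ∈ A → s ≢ t → ¬ Comparable s t

  -- The empty set is an antichain, so ℕ-indexed unions include finite ones.
  Special : Pred Carrier ℓ → Set (suc ℓ)
  Special S = ∃ λ (A : ℕ → Pred Carrier ℓ) → (∀ n → Antichain (A n)) × S ≐ ⋃ ℕ A

  -- A map with domain X is given by a total map of which only the values on X
  -- are used.
  RegressiveOn : Pred Carrier ℓ → (Carrier → Carrier) → Set ℓ
  RegressiveOn X f = ∀ t → t ∈ X → t ≢ root → f t < t

  NS : Pred Carrier ℓ → Set (suc ℓ)
  NS B = ∃ λ (f : Carrier → Carrier) →
    RegressiveOn B f × (∀ t → Special (λ s → s ∈ B × f s ≡ t))

module _ (Ω : Omega₁ ℓ) where
  open Omega₁ Ω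

  Unbounded : Pred Carrier ℓ → Set ℓ
  Unbounded C = ∀ α → ∃ λ β → β ∈ C × α < β

  -- The two premises on δ say that δ is a limit ordinal and that C ∩ δ is
  -- unbounded in δ.
  Closed : Pred Carrier ℓ → Set ℓ
  Closed C = ∀ δ → Satisfiable (δ ↓) →
    (∀ α → α < δ → ∃ λ β → β ∈ C × α < β × β < δ) → δ ∈ C

  Club : Pred Carrier ℓ → Set ℓ
  Club C = Closed C × Unbounded C

  Stationary : Pred Carrier ℓ → Set (suc ℓ)
  Stationary S = ∀ C → Club C → S ≬ C

  ◇ : Set (suc ℓ)
  ◇ = ∃ λ (D : Carrier → Pred Carrier ℓ) →
    (∀ α → D α ⊆ α ↓) ×
    (∀ (X : Pred Carrier ℓ) → Stationary (λ α → (X ∩ α ↓) ≐ D α))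

-- Meaningful for nonspecial trees.
◇[_] : Tree ℓ → Set (suc ℓ)
◇[_] {ℓ} T = ∃ λ (D : Carrier → Pred Carrier ℓ) →
    (∀ t → D t ⊆ t ↓) ×
    (∀ (X : Pred Carrier ℓ) → ¬ NS (λ t → (X ∩ t ↓) ≐ D t))
  where open Tree T

module _ (Ω : Omega₁ ℓ) (T : Tree ℓ) where
  private
    module Ω = Omega₁ Ω
  open Tree T

  -- The nodes t such that t ↓ has the order type of the initial segment I of ω₁.
  NodesOfHeight : Pred Ω.Carrier p → Pred Carrier (ℓ ⊔ p)
  NodesOfHeight I t = SameOrderType _<_ (t ↓) Ω._<_ I

  Level[_] : Ω.Carrier → Pred Carrier ℓ
  Level[ α ] = NodesOfHeight (α Ω.↓)

  -- ω₁ itself is the improper initial segment U.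
  HasHeightω₁ : Set ℓ
  HasHeightω₁ = Empty (NodesOfHeight U) × (∀ α → Satisfiable Level[ α ])

  -- For trees of height ω₁.
  CofinalBranch : Pred Carrier ℓ → Set ℓ
  CofinalBranch B = Chain B × (∀ α → B ≬ Level[ α ])

  Isω₁Tree : Set ℓ
  Isω₁Tree = HasHeightω₁ × (∀ α → Countable Level[ α ])

{-# OPTIONS --safe #-}
module Submission where

-- Along a cofinal branch b, a ◇-sequence guesses X ∩ b α ↓ for stationarily many α,
-- and a regressive map on these nodes with special fibres is impossible: a special
-- set meets the chain b in a countable, hence bounded, set, so pressing down applies.
-- Conversely, any set of nodes whose heights avoid a fixed club lies in NS, so a
-- ◇ₜ-sequence guesses at some node of height in any given club; countable levels
-- then give countably many guesses per ordinal, which suffices by Kunen's argument.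
-- Excluded middle for types rather than propositions yields choice functions, in
-- particular that ω₁ is regular.

open import Defs
open import Level using (Level; suc; lift; lower; Lift)
open import Axiom.ExcludedMiddle using (ExcludedMiddle)
open import Axiom.DoubleNegationElimination using (DoubleNegationElimination; em⇒dne)
open import Data.Nat.Base as ℕ using (ℕ; zero)
import Data.Nat.Properties as ℕ
open import Data.Product.Base using (Σ; ∃; _×_; _,_; proj₁; proj₂)
open import Data.Sum.Base using (inj₁; inj₂)
open import Function.Base using (_on_)
open import Function.Bundles using (_⇔_; mk⇔)
open import Induction.WellFounded using (Acc; acc; WellFounded)
open import Relation.Binary.Core using (Rel)
open import Relation.Binary.Definitions using (tri<; tri≈; tri>)
open import Relation.Binary.Structures using (IsStrictPartialOrder; IsStrictTotalOrder)
open import Relation.Binary.Morphism.Structures using (IsOrderIsomorphism)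
open import Relation.Binary.PropositionalEquality
  using (_≡_; _≢_; refl; sym; trans; cong; subst)
open import Relation.Nullary using (¬_; Dec; yes; no; contradiction)
open import Relation.Nullary.Decidable using (map′)
open import Relation.Unary
  using (Pred; U; _∈_; _∉_; _⊆_; _≐_; _∩_; _≬_; Satisfiable)

private variable
  ℓ p : Level

-- Pairing of natural numbers

pair : ℕ → ℕ → ℕ
pair zero      n = ℕ.suc (2 ℕ.* n)
pair (ℕ.suc m) n = 2 ℕ.* pair m n

-- `pair m n` is `2^m (2n + 1)`: parity tells when the power of two is used up.
pair-injective : ∀ m m′ {n n′} → pair m n ≡ pair m′ n′ → m ≡ m′ × n ≡ n′
pair-injective zero zero {n} {n′} eq = refl , ℕ.*-cancelˡ-≡ n n′ 2 (ℕ.suc-injective eq)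
pair-injective zero (ℕ.suc m′) {n} {n′} eq = contradiction (sym eq) (ℕ.even≢odd (pair m′ n′) n)
pair-injective (ℕ.suc m) zero {n} {n′} eq = contradiction eq (ℕ.even≢odd (pair m n) n′)
pair-injective (ℕ.suc m) (ℕ.suc m′) eq
  with refl , n≡n′ ← pair-injective m m′ (ℕ.*-cancelˡ-≡ (pair m _) (pair m′ _) 2 eq) = refl , n≡n′

lower-em : ExcludedMiddle (suc ℓ) → ExcludedMiddle ℓ
lower-em {ℓ} em {P} = map′ lower lift (em {Lift (suc ℓ) P})

-- Regularity of ω₁ and clubs of closure points

module Ordinal (em : ExcludedMiddle ℓ) (Ω : Omega₁ ℓ) where
  open Omega₁ Ω public
  open IsWellOrder isWellOrder public using (isStrictTotalOrder; wellFounded)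
  open IsStrictTotalOrder isStrictTotalOrder public
    using (compare; irrefl) renaming (trans to <-trans)

  infix 4 _≤_
  _≤_ : Rel Carrier ℓ
  α ≤ β = ¬ (β < α)

  private
    dne : DoubleNegationElimination ℓ
    dne = em⇒dne em

  ≤-<-trans : ∀ {α β γ} → α ≤ β → β < γ → α < γ
  ≤-<-trans {α} {β} α≤β β<γ with compare α β
  ... | tri< α<β _ _  = <-trans α<β β<γ
  ... | tri≈ _ refl _ = β<γ
  ... | tri> _ _ β<α  = contradiction β<α α≤β

  ≤-antisym : ∀ {α β} → α ≤ β → β ≤ α → α ≡ β
  ≤-antisym {α} {β} α≤β β≤α with compare α β
  ... | tri< α<β _ _ = contradiction α<β β≤α
  ... | tri≈ _ eq _  = eq
  ... | tri> _ _ β<α = contradiction β<α α≤β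

  least : (P : Pred Carrier ℓ) → ∃ P → ∃ λ μ → P μ × (∀ {β} → P β → μ ≤ β)
  least P (α , Pα) = go α (wellFounded α) Pα
    where
    go : ∀ α → Acc _<_ α → P α → ∃ λ μ → P μ × (∀ {β} → P β → μ ≤ β)
    go α (acc rs) Pα with em {∃ λ β → P β × β < α}
    ... | yes (β , Pβ , β<α) = go β (rs β<α) Pβ
    ... | no ¬smaller        = α , Pα , λ Pβ β<α → ¬smaller (_ , Pβ , β<α)

  inhabited : Carrier
  inhabited = dne λ ¬α → uncountable ((λ _ → 0) , λ {α} → contradiction α ¬α)

  abstract
    countable-≤ : ∀ α → Countable (_≤ α)
    countable-≤ α = (λ β → code (em {β ≡ α})) , code-injective em em
      where
      code : ∀ {β} → Dec (β ≡ α) → ℕ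
      -- The code 0 is reserved for α itself; the codes below α are shifted up by one.
      code     (yes _) = 0
      code {β} (no _)  = ℕ.suc (proj₁ (countable↓ α) β)

      strict : ∀ {β} → β ≢ α → β ≤ α → β < α
      strict β≢α β≤α = dne λ β≮α → β≢α (≤-antisym β≤α β≮α)

      code-injective : ∀ {β γ} (β≟α : Dec (β ≡ α)) (γ≟α : Dec (γ ≡ α)) →
        β ≤ α → γ ≤ α → code β≟α ≡ code γ≟α → β ≡ γ
      code-injective (yes refl) (yes refl) _   _   _  = refl
      code-injective (no β≢α)   (no γ≢α)   β≤α γ≤α eq =
        proj₂ (countable↓ α) (strict β≢α β≤α) (strict γ≢α γ≤α) (ℕ.suc-injective eq)

    -- Otherwise every β is at most some `a n`, and pairing `n` with the code of β in the countable
    -- segment up to `a n` injects ω₁ into ℕ.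
    bounded-sequence : (a : ℕ → Carrier) → ∃ λ β → ∀ n → a n < β
    bounded-sequence a = dne λ unbounded →
      let
        index : ∀ β → ∃ λ n → β ≤ a n
        index β = dne λ ¬index → unbounded (β , λ n → dne λ an≮β → ¬index (n , an≮β))
      in uncountable
        ( (λ β → code β (index β))
        , λ {β} {γ} _ _ → code-injective (index β) (index γ))
      where
      code : ∀ β → ∃ (λ n → β ≤ a n) → ℕ
      code β (n , _) = pair n (proj₁ (countable-≤ (a n)) β)

      code-injective : ∀ {β γ} (i : ∃ λ n → β ≤ a n) (j : ∃ λ n → γ ≤ a n) →
        code β i ≡ code γ j → β ≡ γ
      code-injective (m , β≤am) (n , γ≤an) eq with pair-injective m n eq
      ... | refl , eq′ = proj₂ (countable-≤ (a m)) β≤am γ≤an eq′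

    bounded-image : {P : Pred Carrier ℓ} → Countable P → (f : Carrier → Carrier) →
      ∃ λ β → ∀ {α} → P α → f α < β
    bounded-image {P} (code , code-injective) f =
      proj₁ bound , λ {α} Pα → subst (_< proj₁ bound) (value-code Pα em) (proj₂ bound (code α))
      where
      value : ∀ {n} → Dec (∃ λ α → P α × code α ≡ n) → Carrier
      value (yes (α , _)) = f α
      -- An arbitrary value at numbers that code no element of `P`, so that the image becomes a
      -- sequence indexed by all of ℕ.
      value (no _)        = inhabited

      value-code : ∀ {α} → P α → (d : Dec (∃ λ β → P β × code β ≡ code α)) → value d ≡ f α
      value-code Pα (yes (β , Pβ , eq)) = cong f (code-injective Pβ Pα eq)
      value-code Pα (no ¬preimage)      = contradiction (_ , Pα , refl) ¬preimage

      bound : ∃ λ β → ∀ n → value (em {∃ λ α → P α × code α ≡ n}) < β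
      bound = bounded-sequence _

  private
    successor : ∀ α → ∃ λ μ → α < μ × (∀ {β} → α < β → μ ≤ β)
    successor α with β , α<β ← bounded-sequence (λ _ → α) = least (α <_) (β , α<β 0)

  sucₒ : Carrier → Carrier
  sucₒ α = proj₁ (successor α)

  α<sucₒ : ∀ α → α < sucₒ α
  α<sucₒ α = proj₁ (proj₂ (successor α))

  sucₒ-least : ∀ {α β} → α < β → sucₒ α ≤ β
  sucₒ-least {α} = proj₂ (proj₂ (successor α))

  sucₒ-injective : ∀ {α β} → sucₒ α ≡ sucₒ β → α ≡ β
  sucₒ-injective {α} {β} eq with compare α β
  ... | tri< α<β _ _ = contradiction (subst (β <_) (sym eq) (α<sucₒ β)) (sucₒ-least α<β)
  ... | tri≈ _ α≡β _ = α≡β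
  ... | tri> _ _ β<α = contradiction (subst (α <_) eq (α<sucₒ α)) (sucₒ-least β<α)

  ClosedUnder : (Carrier → Carrier) → Pred Carrier ℓ
  ClosedUnder h δ = ∀ γ → γ < δ → h γ < δ

  -- The first conjunct excludes 0, which is vacuously closed under every `h`.
  ClosurePoint : (Carrier → Carrier) → Pred Carrier ℓ
  ClosurePoint h δ = Satisfiable (δ ↓) × ClosedUnder h δ

  abstract
    -- For unboundedness, iterate a step that passes all values of `h` below the current ordinal;
    -- the supremum of the ω iterates is a closure point.
    closurePoints-club : ∀ h → Club Ω (ClosurePoint h)
    closurePoints-club h = closed , unbounded
      where
      closed : Closed Ω (ClosurePoint h)
      closed δ nonzero cofinal = nonzero , λ _ γ<δ → case-cofinal (cofinal _ γ<δ)
        where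
        case-cofinal : ∀ {γ} → ∃ (λ β → β ∈ ClosurePoint h × γ < β × β < δ) → h γ < δ
        case-cofinal (β , (_ , hβ) , γ<β , β<δ) = <-trans (hβ _ γ<β) β<δ

      next : ∀ β → ∃ λ β′ → β < β′ × (∀ {γ} → γ < β → h γ < β′)
      next β with μ , h<μ ← bounded-image (countable↓ β) h
             with β′ , bound ← bounded-sequence (λ { zero → β ; (ℕ.suc _) → μ })
             = β′ , bound 0 , λ γ<β → <-trans (h<μ γ<β) (bound 1)

      unbounded : Unbounded Ω (ClosurePoint h)
      unbounded α with least (λ δ → ∀ n → iterate n < δ) (bounded-sequence iterate)
        where
        iterate : ℕ → Carrier
        iterate zero      = α
        iterate (ℕ.suc n) = proj₁ (next (iterate n))
      ... | δ , iterate<δ , δ-least = δ , ((α , iterate<δ 0) , closed-under) , iterate<δ 0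
        where
        closed-under : ClosedUnder h δ
        closed-under γ γ<δ = dne λ hγ≮δ → δ-least
          -- If some iterate `n` is at least γ, then γ is strictly below iterate `n + 1`, so `h γ`
          -- is below iterate `n + 2`, hence below δ. Otherwise γ bounds all iterates, against the
          -- minimality of δ.
          (λ n → dne λ it≮γ → hγ≮δ (<-trans
            (proj₂ (proj₂ (next _)) (≤-<-trans it≮γ (proj₁ (proj₂ (next _)))))
            (iterate<δ (ℕ.suc (ℕ.suc n))))) γ<δ

  -- A point moved downwards stays in the domain by `down`, and by monotonicity its image is moved
  -- downwards again: an infinite descent.
  inflationary : {P : Pred Carrier ℓ} → (∀ {α β} → α < β → P β → P α) →
    (f : Σ Carrier P → Carrier) → (∀ {x y} → proj₁ x < proj₁ y → f x < f y) →
    ∀ x → proj₁ x ≤ f x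
  inflationary {P} down f mono (α , Pα) = go α (wellFounded α) Pα
    where
    go : ∀ α → Acc _<_ α → (Pα : P α) → α ≤ f (α , Pα)
    go α (acc rs) Pα fα<α = go _ (rs fα<α) (down fα<α Pα) (mono fα<α)

  -- Limit ordinals and the coding of ℕ × ω₁ into ω₁

  Limit : Pred Carrier ℓ
  Limit = ClosedUnder sucₒ

  infixl 6 _+ₒ_
  _+ₒ_ : Carrier → ℕ → Carrier
  α +ₒ zero    = α
  α +ₒ ℕ.suc n = sucₒ (α +ₒ n)

  Decomposition : Carrier → Set ℓ
  Decomposition β = ∃ λ α → Limit α × ∃ λ n → α +ₒ n ≡ β

  abstract
    -- Passing to immediate predecessors stops by well-foundedness, and it stops at a `Limit`, since
    -- 0 counts as one.
    decompose : ∀ β → Decomposition β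
    decompose β = go β (wellFounded β)
      where
      go : ∀ β → Acc _<_ β → Decomposition β
      go β (acc rs) with em {∃ λ γ → γ < β × β ≤ sucₒ γ}
      ... | no ¬successor = β , (λ γ γ<β → dne λ sγ≮β → ¬successor (γ , γ<β , sγ≮β)) , 0 , refl
      ... | yes (γ , γ<β , β≤sγ) with α , limit , n , refl ← go γ (rs γ<β) =
        α , limit , ℕ.suc n , ≤-antisym (sucₒ-least γ<β) β≤sγ

  +ₒ-injective : ∀ {α β} → Limit α → Limit β → ∀ m n → α +ₒ m ≡ β +ₒ n → α ≡ β × m ≡ n
  +ₒ-injective limα limβ zero zero eq = eq , refl
  +ₒ-injective {α} {β} limα limβ zero (ℕ.suc n) refl =
    contradiction (limα (β +ₒ n) (α<sucₒ _)) (irrefl refl)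
  +ₒ-injective {α} {β} limα limβ (ℕ.suc m) zero refl =
    contradiction (limβ (α +ₒ m) (α<sucₒ _)) (irrefl refl)
  +ₒ-injective limα limβ (ℕ.suc m) (ℕ.suc n) eq
    with α≡β , refl ← +ₒ-injective limα limβ m n (sucₒ-injective eq) = α≡β , refl

  α≤α+ₒn : ∀ α n → α ≤ α +ₒ n
  α≤α+ₒn α zero      α<α   = irrefl refl α<α
  α≤α+ₒn α (ℕ.suc n) α+n<α = α≤α+ₒn α n (<-trans (α<sucₒ _) α+n<α)

  limit-+ₒ : ∀ {α δ} → Limit δ → α < δ → ∀ n → α +ₒ n < δ
  limit-+ₒ limδ α<δ zero      = α<δ
  limit-+ₒ limδ α<δ (ℕ.suc n) = limδ _ (limit-+ₒ limδ α<δ n)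

  -- An injection ℕ × ω₁ → ω₁ that maps ℕ × δ into δ for every limit δ.
  encode : ℕ → Carrier → Carrier
  encode m β with α , _ , n , _ ← decompose β = α +ₒ pair m n

  encode-injective : ∀ m m′ {β β′} → encode m β ≡ encode m′ β′ → m ≡ m′ × β ≡ β′
  encode-injective m m′ {β} {β′} eq
    with α , limα , n , refl ← decompose β | α′ , limα′ , n′ , refl ← decompose β′
    with refl , pair≡ ← +ₒ-injective limα limα′ (pair m n) (pair m′ n′) eq
    with refl , refl ← pair-injective m m′ pair≡ = refl , refl

  -- Only the finite part of β changes: its limit part is at most β, hence below δ, and δ is closed
  -- under adding finite ordinals.
  encode-< : ∀ m {β δ} → Limit δ → β < δ → encode m β < δ
  encode-< m {β} limδ β<δ with α , _ , n , refl ← decompose β =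
    limit-+ₒ limδ (≤-<-trans (α≤α+ₒn α n) β<δ) (pair m n)

-- Levels and the height function of the tree

module Height (em : ExcludedMiddle ℓ) (Ω : Omega₁ ℓ) (T : Tree ℓ)
  (hasHeightω₁ : HasHeightω₁ Ω T) where
  private
    module Ω = Ordinal em Ω
    dne : DoubleNegationElimination ℓ
    dne = em⇒dne em
  open Tree T
  open IsStrictPartialOrder isStrictPartialOrder public
    using () renaming (irrefl to <-irrefl; trans to <-trans)

  ↓-comparable : ∀ {r s t} → r < t → s < t → Comparable r s
  ↓-comparable {t = t} r<t s<t
    with IsStrictTotalOrder.compare (IsWellOrder.isStrictTotalOrder (wellOrdered↓ t))
           (_ , r<t) (_ , s<t)
  ... | tri< r<s _ _ = inj₁ r<s
  ... | tri≈ _ r≡s _ = inj₂ (inj₁ r≡s)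
  ... | tri> _ _ s<r = inj₂ (inj₂ s<r)

  LevelOf : Ω.Carrier → Pred Carrier ℓ
  LevelOf = Level[_] Ω T

  -- An isomorphism of `t ↓` with an initial segment restricts to one of `s ↓` with the segment
  -- below the image of `s`.
  LevelOf-restrict : ∀ {α s t} ((f , _) : t ∈ LevelOf α) (s<t : s < t) →
    s ∈ LevelOf (proj₁ (f (s , s<t)))
  LevelOf-restrict {α} {s} {t} (f , iso) s<t = g , record
    { isOrderMonomorphism = record
      { isOrderHomomorphism = record { cong = F.cong ; mono = F.mono }
      ; injective = F.injective
      ; cancel    = F.cancel
      }
    ; surjective = λ (γ , γ<fs) → g-surjective γ γ<fs
    }
    where
    module F = IsOrderIsomorphism iso
    fs : Ω.Carrier
    fs = proj₁ (f (s , s<t))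

    g : Σ Carrier (_< s) → Σ Ω.Carrier (Ω._< fs)
    g (r , r<s) = proj₁ (f (r , <-trans r<s s<t)) , F.mono r<s

    g-surjective : ∀ γ → γ Ω.< fs → ∃ λ x → ∀ {z} → proj₁ z ≡ proj₁ x → proj₁ (g z) ≡ γ
    g-surjective γ γ<fs
      with (r , r<t) , fr≡γ ← F.surjective (γ , Ω.<-trans γ<fs (proj₂ (f (s , s<t)))) =
      (r , F.cancel (subst (Ω._< fs) (sym (fr≡γ {r , r<t} refl)) γ<fs)) , fr≡γ

  LevelOf-< : ∀ {α β t} → t ∈ LevelOf α → β Ω.< α → ∃ λ s → s < t × s ∈ LevelOf β
  LevelOf-< t∈α@(f , iso) β<α
    with (s , s<t) , fs≡β ← IsOrderIsomorphism.surjective iso (_ , β<α) =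
    s , s<t , subst (λ β → s ∈ LevelOf β) (fs≡β refl) (LevelOf-restrict t∈α s<t)

  -- If β < α, inverting one isomorphism and applying the other gives an increasing map from α into
  -- β, which moves β downwards.
  LevelOf-≤ : ∀ {α β t} → t ∈ LevelOf α → t ∈ LevelOf β → α Ω.≤ β
  LevelOf-≤ {α} {β} (f , isoF) (g , isoG) β<α =
    Ω.inflationary Ω.<-trans
      (λ y → proj₁ (g (f⁻¹ y))) (λ y<y′ → G.mono (f⁻¹-mono y<y′))
      (β , β<α) (proj₂ (g (f⁻¹ (β , β<α))))
    where
    module F = IsOrderIsomorphism isoF
    module G = IsOrderIsomorphism isoG
    f⁻¹ = λ y → proj₁ (F.surjective y)

    f∘f⁻¹ : ∀ y → proj₁ (f (f⁻¹ y)) ≡ proj₁ y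
    f∘f⁻¹ y = proj₂ (F.surjective y) refl

    f⁻¹-mono : ∀ {y y′} → proj₁ y Ω.< proj₁ y′ → proj₁ (f⁻¹ y) < proj₁ (f⁻¹ y′)
    f⁻¹-mono {y} {y′} y<y′ = F.cancel
      (subst (Ω._< _) (sym (f∘f⁻¹ y)) (subst (_ Ω.<_) (sym (f∘f⁻¹ y′)) y<y′))

  LevelOf-unique : ∀ {α β t} → t ∈ LevelOf α → t ∈ LevelOf β → α ≡ β
  LevelOf-unique t∈α t∈β = Ω.≤-antisym (LevelOf-≤ t∈α t∈β) (LevelOf-≤ t∈β t∈α)

  LevelOf-mono : ∀ {α β s t} → s ∈ LevelOf α → t ∈ LevelOf β → s < t → α Ω.< β
  LevelOf-mono s∈α t∈β@(f , _) s<t =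
    subst (Ω._< _) (LevelOf-unique (LevelOf-restrict t∈β s<t) s∈α) (proj₂ (f (_ , s<t)))

  LevelOf-reflects-≡ : ∀ {α s t} → Comparable s t → s ∈ LevelOf α → t ∈ LevelOf α → s ≡ t
  LevelOf-reflects-≡ (inj₁ s<t)        s∈α t∈α =
    contradiction (LevelOf-mono s∈α t∈α s<t) (Ω.irrefl refl)
  LevelOf-reflects-≡ (inj₂ (inj₁ s≡t)) s∈α t∈α = s≡t
  LevelOf-reflects-≡ (inj₂ (inj₂ t<s)) s∈α t∈α =
    contradiction (LevelOf-mono t∈α s∈α t<s) (Ω.irrefl refl)

  LevelOf-reflects-< : ∀ {α β s t} →
    Comparable s t → s ∈ LevelOf α → t ∈ LevelOf β → α Ω.< β → s < t
  LevelOf-reflects-< (inj₁ s<t)         s∈α t∈β α<β = s<t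
  LevelOf-reflects-< (inj₂ (inj₁ refl)) s∈α t∈β α<β =
    contradiction α<β (LevelOf-≤ t∈β s∈α)
  LevelOf-reflects-< (inj₂ (inj₂ t<s))  s∈α t∈β α<β =
    contradiction (Ω.<-trans α<β (LevelOf-mono t∈β s∈α t<s)) (Ω.irrefl refl)

  -- The heights of the predecessors assemble into the isomorphism. `Q` is general so as to cover
  -- both a proper segment and all of ω₁.
  height-of-↓ : ∀ {t} (Q : Pred Ω.Carrier p) →
    (level : ∀ {s} → s < t → ∃ λ β → β ∈ Q × s ∈ LevelOf β) →
    (∀ {β} → β ∈ Q → ∃ λ s → s < t × s ∈ LevelOf β) →
    t ∈ NodesOfHeight Ω T Q
  height-of-↓ {t = t} Q level onto = f , record
    { isOrderMonomorphism = record
      { isOrderHomomorphism = record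
        { cong = λ { {x} {_ , _} refl → LevelOf-unique (f-level x) (f-level _) }
        ; mono = λ {x} {y} → LevelOf-mono (f-level x) (f-level y)
        }
      ; injective = λ {x} {y} eq → LevelOf-reflects-≡ (comparable x y) (f-level x)
          (subst (λ β → proj₁ y ∈ LevelOf β) (sym eq) (f-level y))
      ; cancel = λ {x} {y} → LevelOf-reflects-< (comparable x y) (f-level x) (f-level y)
      }
    ; surjective = λ (β , β∈Q) → f-surjective β β∈Q
    }
    where
    f : Σ Carrier (_< t) → Σ Ω.Carrier Q
    f (s , s<t) = proj₁ (level s<t) , proj₁ (proj₂ (level s<t))

    f-level : ∀ x → proj₁ x ∈ LevelOf (proj₁ (f x))
    f-level (s , s<t) = proj₂ (proj₂ (level s<t))

    comparable : ∀ (x y : Σ Carrier (_< t)) → Comparable (proj₁ x) (proj₁ y)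
    comparable (_ , s<t) (_ , r<t) = ↓-comparable s<t r<t

    f-surjective : ∀ β → β ∈ Q → ∃ λ x → ∀ {z} → proj₁ z ≡ proj₁ x → proj₁ (f z) ≡ β
    f-surjective β β∈Q with s , s<t , s∈β ← onto β∈Q =
      (s , s<t) , λ { {z} refl → LevelOf-unique (f-level z) s∈β }

  <-wellFounded : WellFounded _<_
  <-wellFounded t = acc λ s<t → go (_ , s<t) (IsWellOrder.wellFounded (wellOrdered↓ t) _)
    where
    go : ∀ (x : Σ Carrier (_< t)) → Acc (_<_ on proj₁) x → Acc _<_ (proj₁ x)
    go (s , s<t) (acc rs) = acc λ r<s → go (_ , <-trans r<s s<t) (rs r<s)

  abstract
    -- By induction the predecessors have heights. If these exhaust ω₁, then `t` has height ω₁,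
    -- which is excluded; otherwise the height of `t` is the least level that does not occur below
    -- `t`.
    height : ∀ t → ∃ λ α → t ∈ LevelOf α
    height t = go t (<-wellFounded t)
      where
      go : ∀ t → Acc _<_ t → ∃ λ α → t ∈ LevelOf α
      go t (acc rs) with em {∃ λ β → ¬ ∃ λ s → s < t × s ∈ LevelOf β}
      ... | no ¬missing = contradiction
        (height-of-↓ U
          (λ s<t → proj₁ (go _ (rs s<t)) , _ , proj₂ (go _ (rs s<t)))
          (λ {β} _ → dne λ ¬occurs → ¬missing (β , ¬occurs)))
        (proj₁ hasHeightω₁ t)
      ... | yes missing with α , α-missing , α-least ← Ω.least _ missing =
        α , height-of-↓ (Ω._< α)
          (λ s<t → let (β , s∈β) = go _ (rs s<t) in β , below s<t s∈β , s∈β)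
          (λ β<α → dne λ β-missing → α-least β-missing β<α)
        where
        below : ∀ {s β} → s < t → s ∈ LevelOf β → β Ω.< α
        below {s} {β} s<t s∈β with Ω.compare β α
        ... | tri< β<α _ _  = β<α
        ... | tri≈ _ refl _ = contradiction (s , s<t , s∈β) α-missing
        ... | tri> _ _ α<β with r , r<s , r∈α ← LevelOf-< s∈β α<β =
          contradiction (r , <-trans r<s s<t , r∈α) α-missing

  ht : Carrier → Ω.Carrier
  ht t = proj₁ (height t)

  ht-level : ∀ t → t ∈ LevelOf (ht t)
  ht-level t = proj₂ (height t)

  ht-unique : ∀ {α t} → t ∈ LevelOf α → ht t ≡ α
  ht-unique = LevelOf-unique (ht-level _)

  ht-mono : ∀ {s t} → s < t → ht s Ω.< ht t
  ht-mono = LevelOf-mono (ht-level _) (ht-level _)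

  ht-reflects-≡ : ∀ {s t} → Comparable s t → ht s ≡ ht t → s ≡ t
  ht-reflects-≡ {s} comparable eq = LevelOf-reflects-≡ comparable
    (subst (λ α → s ∈ LevelOf α) eq (ht-level s)) (ht-level _)

  ht-reflects-< : ∀ {s t} → Comparable s t → ht s Ω.< ht t → s < t
  ht-reflects-< comparable = LevelOf-reflects-< comparable (ht-level _) (ht-level _)

  ht-↓ : ∀ {β t} → β Ω.< ht t → ∃ λ s → s < t × ht s ≡ β
  ht-↓ {t = t} β<ht with s , s<t , s∈β ← LevelOf-< (ht-level t) β<ht = s , s<t , ht-unique s∈β

-- The ideal `NS` and the two diamond principles

module Diamond (em⁺ : ExcludedMiddle (suc ℓ)) (Ω : Omega₁ ℓ) (T : Tree ℓ)
  (hasHeightω₁ : HasHeightω₁ Ω T) where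
  private
    em : ExcludedMiddle ℓ
    em = lower-em em⁺
    dne : DoubleNegationElimination ℓ
    dne = em⇒dne em
    dne⁺ : DoubleNegationElimination (suc ℓ)
    dne⁺ = em⇒dne em⁺
    module Ω = Ordinal em Ω
  open Tree T
  open Height em Ω T hasHeightω₁

  ht-root : ∀ {β} → ¬ (β Ω.< ht root)
  ht-root β<ht with s , s<root , _ ← ht-↓ β<ht with em {s ≡ root}
  ... | yes refl  = <-irrefl refl s<root
  ... | no s≢root = <-irrefl refl (<-trans s<root (root-least s s≢root))

  comparable-antichain : ∀ {A s t} → Antichain A → s ∈ A → t ∈ A → Comparable s t → s ≡ t
  comparable-antichain antichain s∈A t∈A comparable =
    dne λ s≢t → antichain s∈A t∈A s≢t comparable

  -- A node t whose height is not closed under h has a predecessor s of height γ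
  -- with ht t ≤ h γ; the fibres of t ↦ s then meet only countably many levels.
  NS-off-closurePoints : ∀ (h : Ω.Carrier → Ω.Carrier) {A : Pred Carrier ℓ} →
    (∀ {t} → t ∈ A → ht t ∉ Ω.ClosurePoint h) → NS A
  NS-off-closurePoints h {A} off =
    f , (λ t t∈A → proj₁ (f-spec (off t∈A))) , fibre-special
    where
    Escape : Carrier → Pred Carrier ℓ
    Escape t s = (t ≢ root → s < t) × ht t Ω.≤ h (ht s)

    escape : ∀ {t} → ht t ∉ Ω.ClosurePoint h → ∃ (Escape t)
    escape {t} ht∉ with em {∃ λ γ → γ Ω.< ht t × ht t Ω.≤ h γ}
    ... | yes (γ , γ<ht , ht≤hγ) with s , s<t , refl ← ht-↓ γ<ht = s , (λ _ → s<t) , ht≤hγ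
    -- Here `ht t` is closed under `h`, so it fails to be a closure point only by being 0. Then `t`
    -- is the root and may be its own value.
    ... | no closed = t
      , (λ t≢root → contradiction (positive (ht-mono (root-least t t≢root))) ht∉)
      , (λ h<ht → ht∉ (positive h<ht))
      where
      positive : ∀ {β} → β Ω.< ht t → ht t ∈ Ω.ClosurePoint h
      positive β<ht = (_ , β<ht) , λ γ γ<ht → dne λ hγ≮ht → closed (γ , γ<ht , hγ≮ht)

    choose : ∀ {t} → Dec (∃ (Escape t)) → Carrier
    choose     (yes (s , _)) = s
    choose {t} (no _)        = t

    f : Carrier → Carrier
    f t = choose (em {∃ (Escape t)})

    f-spec : ∀ {t} → ht t ∉ Ω.ClosurePoint h → Escape t (f t)
    f-spec {t} ht∉ with em {∃ (Escape t)}
    ... | yes (s , spec) = spec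
    ... | no ¬escape     = contradiction (escape ht∉) ¬escape

    fibre-special : ∀ s → Special (λ t → t ∈ A × f t ≡ s)
    fibre-special s =
      part , antichain , (λ t∈fibre → _ , t∈fibre , refl) , (λ (_ , t∈fibre , _) → t∈fibre)
      where
      countable = Ω.countable-≤ (h (ht s))

      part : ℕ → Pred Carrier ℓ
      part n t = (t ∈ A × f t ≡ s) × proj₁ countable (ht t) ≡ n

      bounded : ∀ {t} → t ∈ A → f t ≡ s → ht t Ω.≤ h (ht s)
      bounded t∈A refl = proj₂ (f-spec (off t∈A))

      antichain : ∀ n → Antichain (part n)
      antichain n ((t∈A , ft) , nt) ((r∈A , fr) , nr) t≢r comparable =
        t≢r (ht-reflects-≡ comparable
          (proj₂ countable (bounded t∈A ft) (bounded r∈A fr) (trans nt (sym nr))))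

  module _ (B : Pred Carrier ℓ) (cofinal : CofinalBranch Ω T B) where
    b : Ω.Carrier → Carrier
    b α = proj₁ (proj₂ cofinal α)

    ht-b : ∀ α → ht (b α) ≡ α
    ht-b α = ht-unique (proj₂ (proj₂ (proj₂ cofinal α)))

    b-chain : ∀ α β → Comparable (b α) (b β)
    b-chain α β = proj₁ cofinal
      (proj₁ (proj₂ (proj₂ cofinal α))) (proj₁ (proj₂ (proj₂ cofinal β)))

    -- The nodes `b α` are closed downwards: `s` and the branch node of the same height both lie
    -- below `b α`, so they are comparable and therefore equal.
    below-b : ∀ {s α} → s < b α → b (ht s) ≡ s
    below-b {s} {α} s<bα = ht-reflects-≡ (↓-comparable bhts<bα s<bα) (ht-b (ht s))
      where
      bhts<bα : b (ht s) < b α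
      bhts<bα = ht-reflects-< (b-chain (ht s) α)
        (subst (Ω._< ht (b α)) (sym (ht-b (ht s))) (ht-mono s<bα))

    abstract
      -- An antichain contains at most one node of the chain, so the index of an antichain through
      -- `b α` determines α. Countably many such α are bounded.
      special-bounded : ∀ {S : Pred Carrier ℓ} → Special S →
        ∃ λ β → ∀ {α} → b α ∈ S → α Ω.< β
      special-bounded {S} (A , antichain , S⊆ , _) =
        Ω.bounded-image (code , λ {α} {β} bα∈S bβ∈S → code-injective bα∈S bβ∈S em em) (λ α → α)
        where
        codeOf : ∀ {α} → Dec (b α ∈ S) → ℕ
        codeOf (yes bα∈S) = proj₁ (S⊆ bα∈S)
        codeOf (no _)     = 0

        code : Ω.Carrier → ℕ
        code α = codeOf {α} em

        code-injective : ∀ {α β} → b α ∈ S → b β ∈ S →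
          (d : Dec (b α ∈ S)) (e : Dec (b β ∈ S)) → codeOf d ≡ codeOf e → α ≡ β
        code-injective {α} {β} _ _ (yes bα∈S) (yes bβ∈S) eq =
          trans (sym (ht-b α)) (trans (cong ht bα≡bβ) (ht-b β))
          where
          bα≡bβ : b α ≡ b β
          bα≡bβ = comparable-antichain (antichain (codeOf (yes bβ∈S)))
            (subst (λ n → b α ∈ A n) eq (proj₂ (S⊆ bα∈S))) (proj₂ (S⊆ bβ∈S)) (b-chain α β)
        code-injective bα∈S _ (no bα∉S) _ _ = contradiction bα∈S bα∉S
        code-injective _ bβ∈S _ (no bβ∉S) _ = contradiction bβ∈S bβ∉S

    -- Pressing down: closing under bounds for the fibres of a regressive function
    -- produces a point of S that lies below the bound of its own fibre.
    stationary-not-NS : ∀ {S : Pred Ω.Carrier ℓ} {A : Pred Carrier ℓ} → Stationary Ω S →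
      (∀ {α} → α ∈ S → b α ∈ A) → ¬ NS A
    stationary-not-NS {S} {A} stationary S⊆A (f , regressive , special) =
      disjoint (stationary _ (Ω.closurePoints-club h))
      where
      bound : Carrier → Ω.Carrier
      bound s = proj₁ (special-bounded (special s))

      h : Ω.Carrier → Ω.Carrier
      h γ = bound (b γ)

      disjoint : ¬ (S ≬ Ω.ClosurePoint h)
      disjoint (α , α∈S , (β , β<α) , closed) =
        Ω.irrefl refl (Ω.<-trans α<hγ (closed γ γ<α))
        where
        bα≢root : b α ≢ root
        bα≢root bα≡root =
          ht-root (subst (β Ω.<_) (trans (sym (ht-b α)) (cong ht bα≡root)) β<α)

        fbα<bα : f (b α) < b α
        fbα<bα = regressive (b α) (S⊆A α∈S) bα≢root

        γ : Ω.Carrier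
        γ = ht (f (b α))

        γ<α : γ Ω.< α
        γ<α = subst (γ Ω.<_) (ht-b α) (ht-mono fbα<bα)

        -- The value `f (b α)` is on the branch, namely `b γ`; so `b α` is in the fibre over `b γ`,
        -- which `h γ` bounds.
        α<hγ : α Ω.< h γ
        α<hγ = proj₂ (special-bounded (special (b γ))) (S⊆A α∈S , sym (below-b fbα<bα))

    -- Heights identify the predecessors of `b α` with α, so a correct guess of the trace of `X` on
    -- the branch becomes a correct guess at the node `b α`.
    ◇⇒◇ₜ : ◇ Ω → ◇[ T ]
    ◇⇒◇ₜ (D , _ , guess) = Dₜ , (λ _ {_} → proj₁) , λ X →
      stationary-not-NS (guess (λ β → b β ∈ X)) (guessed X)
      where
      Dₜ : Carrier → Pred Carrier ℓ
      Dₜ t s = s < t × ht s ∈ D (ht t)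

      guessed : ∀ X {α} → ((λ β → b β ∈ X) ∩ (Ω._< α)) ≐ D α → (X ∩ (_< b α)) ≐ Dₜ (b α)
      guessed X {α} (⊆D , D⊆) =
          (λ {s} (s∈X , s<bα) → s<bα , subst (λ β → ht s ∈ D β) (sym (ht-b α))
            (⊆D (subst (_∈ X) (sym (below-b s<bα)) s∈X , subst (ht s Ω.<_) (ht-b α) (ht-mono s<bα))))
        , (λ {s} (s<bα , hts∈D) → subst (_∈ X) (below-b s<bα)
            (proj₁ (D⊆ (subst (λ β → ht s ∈ D β) (ht-b α) hts∈D))) , s<bα)

  -- Kunen's ◇⁻ ⇒ ◇: the countably many guesses on level α are read as guesses of
  -- a sequence (X n), and if no n worked, the counterexamples X n would form a
  -- sequence that is never guessed.
  ◇ₜ⇒◇ : (∀ α → Countable (LevelOf α)) → ◇[ T ] → ◇ Ω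
  ◇ₜ⇒◇ countable (D , _ , guess) = dne⁺ λ ¬◇ →
    no-counterexamples λ n → dne⁺ λ ¬counterexample → ¬◇
      (Dₙ n , (λ _ {_} → proj₁) , λ X C club → dne λ ¬meet → ¬counterexample (X , C , club , ¬meet))
    where
    code : Ω.Carrier → Carrier → ℕ
    code α = proj₁ (countable α)

    -- Coordinate `n` of the guess at the node with code `n` on level α; the guess is empty if there
    -- is no such node.
    Dₙ : ℕ → Ω.Carrier → Pred Ω.Carrier ℓ
    Dₙ n α ξ = ξ Ω.< α × ∃ λ t → (ht t ≡ α × code α t ≡ n) ×
      ∃ λ s → s ∈ D t × ht s ≡ Ω.encode n ξ

    Guesses : ℕ → Pred Ω.Carrier ℓ → Pred Ω.Carrier ℓ
    Guesses n X α = (X ∩ (Ω._< α)) ≐ Dₙ n α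

    no-counterexamples : ¬ (∀ n → ∃ λ X → ∃ λ C → Club Ω C × ¬ (Guesses n X ≬ C))
    no-counterexamples counterexample = guess X̃ (NS-off-closurePoints h off)
      where
      X C : ℕ → Pred Ω.Carrier ℓ
      X n = proj₁ (counterexample n)
      C n = proj₁ (proj₂ (counterexample n))
      C-club : ∀ n → Club Ω (C n)
      C-club n = proj₁ (proj₂ (proj₂ (counterexample n)))

      -- One set of nodes, a union of whole levels, codes the entire sequence of counterexamples.
      X̃ : Pred Carrier ℓ
      X̃ s = ∃ λ n → ∃ λ ξ → ξ ∈ X n × ht s ≡ Ω.encode n ξ

      -- Index 0 makes the closure points of `h` limits; index `n + 1` makes `C n` unbounded in
      -- them, so that they lie in every `C n`.
      above : Ω.Carrier → ℕ → Ω.Carrier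
      above γ zero      = Ω.sucₒ γ
      above γ (ℕ.suc n) = proj₁ (proj₂ (C-club n) γ)

      h : Ω.Carrier → Ω.Carrier
      h γ = proj₁ (Ω.bounded-sequence (above γ))

      above<h : ∀ γ n → above γ n Ω.< h γ
      above<h γ = proj₂ (Ω.bounded-sequence (above γ))

      limit : ∀ {δ} → δ ∈ Ω.ClosurePoint h → Ω.Limit δ
      limit (_ , closed) γ γ<δ = Ω.<-trans (above<h γ 0) (closed γ γ<δ)

      in-C : ∀ {δ} n → δ ∈ Ω.ClosurePoint h → δ ∈ C n
      in-C n (nonzero , closed) = proj₁ (C-club n) _ nonzero λ γ γ<δ →
        let β , β∈C , γ<β = proj₂ (C-club n) γ
        in β , β∈C , γ<β , Ω.<-trans (above<h γ (ℕ.suc n)) (closed γ γ<δ)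

      off : ∀ {t} → (X̃ ∩ (_< t)) ≐ D t → ht t ∉ Ω.ClosurePoint h
      off {t} (⊆D , D⊆) ht∈ = proj₂ (proj₂ (proj₂ (counterexample n)))
        (ht t , (X⊆Dₙ , Dₙ⊆X) , in-C n ht∈)
        where
        -- The guessing node selects the coordinate by its own code on its level.
        n : ℕ
        n = code (ht t) t

        X⊆Dₙ : (X n ∩ (Ω._< ht t)) ⊆ Dₙ n (ht t)
        X⊆Dₙ {ξ} (ξ∈X , ξ<ht)
          -- As `ht t` is a limit, the code of `(n , ξ)` stays below it and is the height of a
          -- predecessor of `t`.
          with s , s<t , hts ← ht-↓ (Ω.encode-< n (limit ht∈) ξ<ht) =
          ξ<ht , t , (refl , refl) , s , ⊆D ((n , ξ , ξ∈X , hts) , s<t) , hts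

        Dₙ⊆X : Dₙ n (ht t) ⊆ (X n ∩ (Ω._< ht t))
        Dₙ⊆X {ξ} (ξ<ht , t′ , (ht′ , code′) , s , s∈D , hts)
          -- The nodes `t′` and `t` share level and code, so they coincide.
          with refl ← proj₂ (countable (ht t))
                 (subst (λ α → t′ ∈ LevelOf α) ht′ (ht-level t′)) (ht-level t) code′
          with (n′ , ξ′ , ξ′∈X , hts′) , _ ← D⊆ s∈D
          with n≡n′ , refl ← Ω.encode-injective n n′ (trans (sym hts) hts′) =
          subst (λ m → ξ ∈ X m) (sym n≡n′) ξ′∈X , ξ<ht

corollary3p20 : ∀ {ℓ} → ExcludedMiddle (suc ℓ) →
    (Ω : Omega₁ ℓ) (T : Tree ℓ) →
    HasHeightω₁ Ω T →
    ∃ (CofinalBranch Ω T) →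
    (◇ Ω → ◇[ T ]) × (Isω₁Tree Ω T → ◇ Ω ⇔ ◇[ T ])
corollary3p20 em Ω T hasHeight (B , cofinal) =
  ◇⇒◇ₜ B cofinal , λ (_ , countable) → mk⇔ (◇⇒◇ₜ B cofinal) (◇ₜ⇒◇ countable)
  where open Diamond em Ω T hasHeight
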